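{- Let $H$ be a hierarchical hub labeling of a tree $T$ on $n$ vertices that is optimal for HL$_1$ (i.e. $\sum_u|H_u|$ is minimum among all hub labelings of $T$). Then $\max_{u\in T}|H_u|=O(\log n)$.
   Context: For a tree $T=(V,E)$ and $u,v\in V$, let $P_{uv}$ be the vertex set of the unique $u$–$v$ path ($P_{uu}=\{u\}$). A hub labeling of $T$ is a family $\{H_u\}_{u\in V}$ of subsets of $V$ with $H_u\cap H_v\cap P_{uv}\neq\varnothing$ for all $u,v\in V$ (including $u=v$). HL$_1$ is the problem of minimizing $\sum_{u\in V}|H_u|$. Writing $u\preceq v$ if $u\in H_v$, the labeling is hierarchical if $\preceq$ is a partial order on $V$. -}

module Defs where

open import Data.Nat using (ℕ; _≤_)
open import Data.Fin using (Fin)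
open import Data.Fin.Subset using (Subset; ∣_∣) renaming (_∈_ to _∈ₛ_)
open import Data.List using (List; []; _∷_; [_]; map; allFin)
open import Data.Nat.ListAction using (sum)
open import Data.List.Membership.Propositional using () renaming (_∈_ to _∈ₗ_)
open import Data.List.Relation.Unary.Unique.Propositional using (Unique)
open import Data.Product using (_×_; ∃-syntax; Σ-syntax)
open import Relation.Binary.PropositionalEquality using (_≡_)
open import Relation.Nullary using (¬_)

record Graph (n : ℕ) : Set₁ where
  field
    Adj   : Fin n → Fin n → Set
    sym   : ∀ {u v} → Adj u v → Adj v u
    irrefl : ∀ {u} → ¬ Adj u u

module _ {n : ℕ} (G : Graph n) where
  open Graph G

  data Walk : Fin n → Fin n → List (Fin n) → Set where
    here : ∀ {u} → Walk u u [ u ]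
    step : ∀ {u w v vs} → Adj u w → Walk w v vs → Walk u v (u ∷ vs)

  IsPath : Fin n → Fin n → List (Fin n) → Set
  IsPath u v vs = Walk u v vs × Unique vs

  IsTree : Set
  IsTree = (∀ u v → ∃[ vs ] IsPath u v vs)
         × (∀ u v vs ws → IsPath u v vs → IsPath u v ws → vs ≡ ws)

  Labeling : Set
  Labeling = Fin n → Subset n

  IsHubLabeling : Labeling → Set
  IsHubLabeling H = ∀ u v vs → IsPath u v vs →
    ∃[ w ] (w ∈ₛ H u × w ∈ₛ H v × w ∈ₗ vs)

  totalSize : Labeling → ℕ
  totalSize H = sum (map (λ u → ∣ H u ∣) (allFin n))

  IsOptimalHL₁ : Labeling → Set
  IsOptimalHL₁ H = IsHubLabeling H × (∀ H' → IsHubLabeling H' → totalSize H ≤ totalSize H')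

  _⪯[_]_ : Fin n → Labeling → Fin n → Set
  u ⪯[ H ] v = u ∈ₛ H v

  IsHierarchical : Labeling → Set
  IsHierarchical H = (∀ u → u ⪯[ H ] u)
                   × (∀ u v → u ⪯[ H ] v → v ⪯[ H ] u → u ≡ v)
                   × (∀ u v w → u ⪯[ H ] v → v ⪯[ H ] w → u ⪯[ H ] w)

{-# OPTIONS --safe #-}
-- Let w ⪯ v mean w ∈ H v, and let d w be the number of v with w ⪯ v.  Comparing H with
-- the labeling {w : w ⪯ x for all x on the path from w to u}, optimality shows that a hub w
-- of u precedes the whole path from w to u, so that every H u is a chain.
--
-- Fix w, let D = {v : w ⪯ v}, and let c be a centroid of D.  Adding c to the label of
-- every v in D makes each hub x of v with w ⪯ x redundant as soon as c lies on the path from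
-- x to v, which for each x happens for at least d x − d w / 2 vertices v.  By optimality the
-- savings are at most the cost d w, so at most three x with w ⪯ x satisfy d x > (3/4) d w.
-- Hence along the chain H u the values d drop by a factor 3/4 every three steps.
module Submission where

open import Defs
import Algebra.Properties.Semiring.Sum
open import Data.Bool using (true; false; if_then_else_)
open import Data.Fin using (Fin; zero; suc)
open import Data.Fin.Properties using (_≟_; any?; all?)
open import Data.Fin.Subset using (Subset; ∣_∣; ⁅_⁆) renaming (_∈_ to _∈ₛ_)
open import Data.Fin.Subset.Properties using (_∈?_; x∈⁅x⁆; ∣⁅x⁆∣≡1; p⊂q⇒∣p∣<∣q∣; p⊆q⇒∣p∣≤∣q∣)
open import Data.List as List using (List; []; _∷_; length; allFin)
open import Data.List.Membership.Propositional using () renaming (_∈_ to _∈ₗ_)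
open import Data.List.Membership.Propositional.Properties using (∈-allFin)
open import Data.List.Membership.DecPropositional using () renaming (_∈?_ to ∈ₗ-dec)
open import Data.List.Properties using (map-tabulate)
open import Data.List.Relation.Unary.All as All using ([]; _∷_)
open import Data.List.Relation.Unary.All.Properties using (¬Any⇒All¬)
open import Data.List.Relation.Unary.AllPairs using ([]; _∷_)
open import Data.List.Relation.Unary.Any using (here; there)
import Data.Nat.ListAction as ℕList
open import Data.Nat using (ℕ; zero; suc; _+_; _*_; _^_; _≤_; _<_; z≤n; s≤s; _<?_)
open import Data.Nat.Logarithm using (⌊log₂_⌋; ⌊log₂⌋-mono-≤; ⌊log₂[2^n]⌋≡n)
open import Data.Nat.Properties hiding (_≟_)
open import Data.Nat.Tactic.RingSolver using (solve-∀)
open import Data.Product using (_×_; _,_; proj₁; proj₂; ∃-syntax)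
open import Data.Sum using (_⊎_; inj₁; inj₂)
open import Data.Unit using (⊤; tt)
open import Data.Vec using ([]; _∷_; tabulate)
open import Data.Vec.Properties using (lookup∘tabulate; []=⇒lookup; lookup⇒[]=)
open import Function using (_∘_)
open import Relation.Binary.PropositionalEquality using (_≡_; _≢_; refl; sym; trans; cong; cong₂; subst)
open import Relation.Nullary using (¬_; Dec; yes; no; does; ¬?; contradiction)
open import Relation.Nullary.Decidable using (_×-dec_; _⊎-dec_; _→-dec_; dec-true)
open import Relation.Unary using (Decidable)

open Algebra.Properties.Semiring.Sum +-*-semiring using (∑-comm; ∑-distrib-+; *-distribˡ-sum)
  renaming (sum to ∑)

private
  variable
    n : ℕ
    A B C D : Set
    P Q R S : Fin n → Set

-- Sums and counting over Fin n

∑-mono : {f g : Fin n → ℕ} → (∀ i → f i ≤ g i) → ∑ f ≤ ∑ g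
∑-mono {zero}  f≤g = z≤n
∑-mono {suc n} f≤g = +-mono-≤ (f≤g zero) (∑-mono (f≤g ∘ suc))

-- Turns minimality of a total into information at every index: strict inequality anywhere would
-- make the sum of `f` smaller than that of `g`.
∑-tight : {f g : Fin n → ℕ} → (∀ i → f i ≤ g i) → ∑ g ≤ ∑ f → ∀ i → g i ≤ f i
∑-tight {suc n} {f} {g} f≤g ∑g≤∑f zero = +-cancelʳ-≤ (∑ (g ∘ suc)) (g zero) (f zero)
  (≤-trans ∑g≤∑f (+-monoʳ-≤ (f zero) (∑-mono (f≤g ∘ suc))))
∑-tight {suc n} {f} {g} f≤g ∑g≤∑f (suc i) = ∑-tight (f≤g ∘ suc)
  (+-cancelˡ-≤ (g zero) _ _ (≤-trans ∑g≤∑f (+-monoˡ-≤ (∑ (f ∘ suc)) (f≤g zero)))) i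

sum-allFin : (f : Fin n → ℕ) → ℕList.sum (List.map f (allFin n)) ≡ ∑ f
sum-allFin {n} f = trans (cong ℕList.sum (map-tabulate (λ i → i) f)) (sum-tabulate f)
  where
  sum-tabulate : ∀ {m} (g : Fin m → ℕ) → ℕList.sum (List.tabulate g) ≡ ∑ g
  sum-tabulate {zero}  g = refl
  sum-tabulate {suc m} g = cong (g zero +_) (sum-tabulate (g ∘ suc))

-- Indicators and counting of decidable predicates

χ : Dec A → ℕ
χ a? = if does a? then 1 else 0

χ-yes : (a? : Dec A) → A → χ a? ≡ 1
χ-yes (yes _) a = refl
χ-yes (no ¬a) a = contradiction a ¬a

χ-no : (a? : Dec A) → ¬ A → χ a? ≡ 0
χ-no (yes a) ¬a = contradiction a ¬a
χ-no (no _)  ¬a = refl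

χ-mono : (a? : Dec A) (b? : Dec B) → (A → B) → χ a? ≤ χ b?
χ-mono (yes a) b? f rewrite χ-yes b? (f a) = ≤-refl
χ-mono (no _)  b? f = z≤n

χ-cover : (a? : Dec A) (b? : Dec B) (c? : Dec C) → (A → B ⊎ C) → χ a? ≤ χ b? + χ c?
χ-cover (no _)  b? c? f = z≤n
χ-cover (yes a) b? c? f with f a
... | inj₁ b rewrite χ-yes b? b = s≤s z≤n
... | inj₂ c rewrite χ-yes c? c = m≤n+m 1 (χ b?)

-- Bookkeeping for changing a label: `A` is membership in the new label, `B` being discarded, `C`
-- membership in the old label, `D` being added. A kept element is not discarded, so `C` pays for
-- `A` alone; for an added one, `D` pays for `A` and `C` for `B`.
χ-exchange : (a? : Dec A) (b? : Dec B) (c? : Dec C) (d? : Dec D) →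
             (A → (C × ¬ B) ⊎ D) → (B → C) → χ a? + χ b? ≤ χ c? + χ d?
χ-exchange (no _)  b?      c? d? f g = ≤-trans (χ-mono b? c? g) (m≤m+n _ _)
χ-exchange (yes a) b?      c? d? f g with f a
χ-exchange (yes a) (yes b) c? d? f g | inj₁ (_ , ¬b) = contradiction b ¬b
χ-exchange (yes a) (no _)  c? d? f g | inj₁ (c , _) rewrite χ-yes c? c = s≤s z≤n
χ-exchange (yes a) b?      c? d? f g | inj₂ d rewrite χ-yes d? d =
  ≤-trans (+-monoʳ-≤ 1 (χ-mono b? c? g)) (≤-reflexive (+-comm 1 (χ c?)))

count : Decidable P → ℕ
count P? = ∑ (λ i → χ (P? i))

count-mono : (P? : Decidable P) (Q? : Decidable Q) → (∀ i → P i → Q i) → count P? ≤ count Q?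
count-mono P? Q? f = ∑-mono (λ i → χ-mono (P? i) (Q? i) (f i))

count-cover : (P? : Decidable P) (Q? : Decidable Q) (R? : Decidable R) →
              (∀ i → P i → Q i ⊎ R i) → count P? ≤ count Q? + count R?
count-cover P? Q? R? f = ≤-trans (∑-mono (λ i → χ-cover (P? i) (Q? i) (R? i) (f i)))
  (≤-reflexive (∑-distrib-+ _ (λ i → χ (R? i))))

count-exchange : (P? : Decidable P) (Q? : Decidable Q) (R? : Decidable R) (S? : Decidable S) →
                 (∀ i → P i → (R i × ¬ Q i) ⊎ S i) → (∀ i → Q i → R i) →
                 count P? + count Q? ≤ count R? + count S?
count-exchange P? Q? R? S? f g = begin
  count P? + count Q?                    ≡⟨ ∑-distrib-+ _ (λ i → χ (Q? i)) ⟨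
  ∑ (λ i → χ (P? i) + χ (Q? i))          ≤⟨ ∑-mono (λ i → χ-exchange (P? i) (Q? i) (R? i) (S? i) (f i) (g i)) ⟩
  ∑ (λ i → χ (R? i) + χ (S? i))          ≡⟨ ∑-distrib-+ _ (λ i → χ (S? i)) ⟩
  count R? + count S?                    ∎
  where open ≤-Reasoning

-- Markov's inequality, in product form to avoid division.
count-markov : (P? : Decidable P) (f : Fin n → ℕ) (m : ℕ) →
               (∀ i → P i → m ≤ f i) → count P? * m ≤ ∑ f
count-markov {n = zero}  P? f m h = z≤n
count-markov {n = suc n} P? f m h = begin
  (χ (P? zero) + count (P? ∘ suc)) * m     ≡⟨ *-distribʳ-+ m (χ (P? zero)) _ ⟩
  χ (P? zero) * m + count (P? ∘ suc) * m   ≤⟨ +-mono-≤ (χ-markov (P? zero) (h zero)) (count-markov (P? ∘ suc) (f ∘ suc) m (h ∘ suc)) ⟩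
  f zero + ∑ (f ∘ suc)                     ∎
  where
  open ≤-Reasoning
  χ-markov : ∀ {k} (a? : Dec A) → (A → m ≤ k) → χ a? * m ≤ k
  χ-markov (yes a) m≤k = ≤-trans (≤-reflexive (*-identityˡ m)) (m≤k a)
  χ-markov (no _)  m≤k = z≤n

count-none : {P : Fin n → Set} (P? : Decidable P) → (∀ i → ¬ P i) → count P? ≡ 0
count-none {n = zero}  P? none = refl
count-none {n = suc n} P? none = cong₂ _+_ (χ-no (P? zero) (none zero)) (count-none (P? ∘ suc) (none ∘ suc))

count-positive : (P? : Decidable P) → ∀ i → P i → 1 ≤ count P?
count-positive P? zero    p rewrite χ-yes (P? zero) p = s≤s z≤n
count-positive P? (suc i) p = ≤-trans (count-positive (P? ∘ suc) i p) (m≤n+m _ (χ (P? zero)))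

count≤n : {P : Fin n → Set} (P? : Decidable P) → count P? ≤ n
count≤n {n = zero}  P? = z≤n
count≤n {n = suc n} P? = +-mono-≤ (χ-mono (P? zero) (yes tt) (λ _ → tt)) (count≤n (P? ∘ suc))

∣p∣≡count : (p : Subset n) → ∣ p ∣ ≡ count (_∈? p)
∣p∣≡count []          = refl
∣p∣≡count (true  ∷ p) = cong suc (∣p∣≡count p)
∣p∣≡count (false ∷ p) = ∣p∣≡count p

subset : {P : Fin n → Set} → Decidable P → Subset n
subset P? = tabulate (does ∘ P?)

∈-subset⁺ : (P? : Decidable P) → ∀ {i} → P i → i ∈ₛ subset P?
∈-subset⁺ P? {i} p = lookup⇒[]= i _ (trans (lookup∘tabulate (does ∘ P?) i) (dec-true (P? i) p))

∈-subset⁻ : (P? : Decidable P) → ∀ {i} → i ∈ₛ subset P? → P i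
∈-subset⁻ P? {i} i∈ with P? i | trans (sym (lookup∘tabulate (does ∘ P?) i)) ([]=⇒lookup i∈)
... | yes p | _  = p
... | no _  | ()

^-distribˡ-* : ∀ a b k → (a * b) ^ k ≡ a ^ k * b ^ k
^-distribˡ-* a b zero    = refl
^-distribˡ-* a b (suc k) = trans (cong (a * b *_) (^-distribˡ-* a b k)) (interchange a b (a ^ k) (b ^ k))
  where
  interchange : ∀ a b c d → a * b * (c * d) ≡ a * c * (b * d)
  interchange = solve-∀

-- Run through all elements with a current candidate. Whenever the next element satisfies `Q`,
-- directedness supplies a common lower bound as new candidate, and transitivity keeps the earlier
-- comparisons.
directed⇒least : (_≼_ : Fin n → Fin n → Set) → (∀ {x y z} → x ≼ y → y ≼ z → x ≼ z) →
                 Decidable Q → (∀ {x y} → Q x → Q y → ∃[ z ] (Q z × z ≼ x × z ≼ y)) →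
                 ∀ {x} → Q x → ∃[ z ] (Q z × (∀ y → Q y → z ≼ y))
directed⇒least {n = n} {Q = Q} _≼_ ≼-trans Q? directed {x₀} q₀ =
  let z , qz , z≼ = below (allFin n) in z , qz , λ y → z≼ (∈-allFin y)
  where
  below : ∀ ys → ∃[ z ] (Q z × (∀ {y} → y ∈ₗ ys → Q y → z ≼ y))
  below [] = x₀ , q₀ , λ ()
  below (y ∷ ys) with below ys | Q? y
  ... | z , qz , z≼ | no ¬qy = z , qz , λ where
    (here refl) qy → contradiction qy ¬qy
    (there y∈)  q  → z≼ y∈ q
  ... | z , qz , z≼ | yes qy with directed qz qy
  ...   | t , qt , t≼z , t≼y = t , qt , λ where
    (here refl) _ → t≼y
    (there y∈)  q → ≼-trans t≼z (z≼ y∈ q)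

-- Paths in trees

module TreePaths {n} (G : Graph n) (tree : IsTree G) where
  open Graph G renaming (sym to Adj-sym)

  path : Fin n → Fin n → List (Fin n)
  path u v = proj₁ (proj₁ tree u v)

  path-isPath : ∀ u v → IsPath G u v (path u v)
  path-isPath u v = proj₂ (proj₁ tree u v)

  path-unique : ∀ {u v vs} → IsPath G u v vs → path u v ≡ vs
  path-unique p = proj₂ tree _ _ _ _ (path-isPath _ _) p

  _∈path?_,_ : ∀ x u v → Dec (x ∈ₗ path u v)
  x ∈path? u , v = ∈ₗ-dec _≟_ x (path u v)

  walk-start : ∀ {u v vs} → Walk G u v vs → u ∈ₗ vs
  walk-start here       = here refl
  walk-start (step _ _) = here refl

  walk-end : ∀ {u v vs} → Walk G u v vs → v ∈ₗ vs
  walk-end here       = here refl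
  walk-end (step _ w) = there (walk-end w)

  -- The length bound is recorded for the distance comparison in `step-towards`.
  suffix : ∀ {u v x vs} → IsPath G u v vs → x ∈ₗ vs →
           ∃[ ws ] (IsPath G x v ws × (∀ {y} → y ∈ₗ ws → y ∈ₗ vs) × length ws ≤ length vs)
  suffix p@(here , _)     (here refl) = _ , p , (λ y∈ → y∈) , ≤-refl
  suffix p@(step _ _ , _) (here refl) = _ , p , (λ y∈ → y∈) , ≤-refl
  suffix (step _ w , _ ∷ uq) (there x∈) with suffix (w , uq) x∈
  ... | ws , p , ws⊆ , ws≤ = ws , p , there ∘ ws⊆ , m≤n⇒m≤1+n ws≤

  erase-loops : ∀ {u v vs} → Walk G u v vs → ∃[ ws ] (IsPath G u v ws × (∀ {y} → y ∈ₗ ws → y ∈ₗ vs))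
  erase-loops here = _ , (here , [] ∷ []) , λ y∈ → y∈
  erase-loops {u} (step a w) with erase-loops w
  ... | ws , p , ws⊆ with ∈ₗ-dec _≟_ u ws
  ...   | yes u∈ with suffix p u∈
  ...     | zs , q , zs⊆ , _ = zs , q , there ∘ ws⊆ ∘ zs⊆
  erase-loops {u} (step a w) | ws , p , ws⊆ | no u∉ =
    u ∷ ws , (step a (proj₁ p) , ¬Any⇒All¬ ws u∉ ∷ proj₂ p) , λ where
      (here eq)  → here eq
      (there y∈) → there (ws⊆ y∈)

  -- Walks confined to a set, and betweenness

  WalkWithin : (Fin n → Set) → Fin n → Fin n → Set
  WalkWithin S u v = ∃[ vs ] (Walk G u v vs × (∀ {x} → x ∈ₗ vs → S x))

  module _ {S : Fin n → Set} where
    concat : ∀ {u v w vs} → Walk G u v vs → (∀ {x} → x ∈ₗ vs → S x) → WalkWithin S v w → WalkWithin S u w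
    concat here       _  q = q
    concat (step a p) ⊆S q with concat p (⊆S ∘ there) q
    ... | zs , r , zs⊆S = _ , step a r , λ where
      (here refl) → ⊆S (here refl)
      (there y∈)  → zs⊆S y∈

    reverse : ∀ {u v vs} → Walk G u v vs → (∀ {x} → x ∈ₗ vs → S x) → WalkWithin S v u
    reverse here       ⊆S = _ , here , ⊆S
    reverse (step a p) ⊆S with reverse p (⊆S ∘ there)
    ... | _ , q , qs⊆S = concat q qs⊆S (_ , step (Adj-sym a) here , λ where
      (here refl)         → ⊆S (there (walk-start p))
      (there (here refl)) → ⊆S (here refl))

    -- Loop erasure turns any walk into the unique path without new vertices, so a property of path
    -- vertices can be read off from any convenient walk.
    path-within : ∀ {u v} → WalkWithin S u v → ∀ {x} → x ∈ₗ path u v → S x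
    path-within (_ , w , ⊆S) x∈ with erase-loops w
    ... | ws , p , ws⊆ = ⊆S (ws⊆ (subst (_ ∈ₗ_) (path-unique p) x∈))

  path-walk : ∀ u v → Walk G u v (path u v)
  path-walk u v = proj₁ (path-isPath u v)

  start∈path : ∀ u v → u ∈ₗ path u v
  start∈path u v = walk-start (path-walk u v)

  end∈path : ∀ u v → v ∈ₗ path u v
  end∈path u v = walk-end (path-walk u v)

  path-sym : ∀ {u v x} → x ∈ₗ path u v → x ∈ₗ path v u
  path-sym {u} {v} = path-within (reverse (path-walk v u) (λ x∈ → x∈))

  path-triangle : ∀ {u v w x} → x ∈ₗ path u w → x ∈ₗ path u v ⊎ x ∈ₗ path v w
  path-triangle {u} {v} {w} = path-within (concat (path-walk u v) inj₁ (_ , path-walk v w , inj₂))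

  suffix-⊆ : ∀ {u v x y} → x ∈ₗ path u v → y ∈ₗ path x v → y ∈ₗ path u v
  suffix-⊆ {u} {v} x∈ y∈ with suffix (path-isPath u v) x∈
  ... | ws , p , ws⊆ , _ = ws⊆ (subst (_ ∈ₗ_) (path-unique p) y∈)

  -- A detour through `v` replaces `path x y` by `path x v` and `path v y`; up to reversal both are
  -- suffixes of `path u v`.
  path-convex : ∀ {u v x y z} → x ∈ₗ path u v → y ∈ₗ path u v → z ∈ₗ path x y → z ∈ₗ path u v
  path-convex {v = v} x∈ y∈ z∈ with path-triangle {v = v} z∈
  ... | inj₁ z∈xv = suffix-⊆ x∈ z∈xv
  ... | inj₂ z∈vy = suffix-⊆ y∈ (path-sym z∈vy)

  -- c' is the neighbour of c towards x.
  step-towards : ∀ {c x} → x ≢ c → ∃[ c' ]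
    ((∀ v → length (path c' v) ≤ suc (length (path c v))) ×
     (∀ v → ¬ c ∈ₗ path x v → suc (length (path c' v)) ≤ length (path c v)))
  step-towards {c} {x} x≢c with path c x | path-isPath c x
  ... | _ | here , _ = contradiction refl x≢c
  ... | _ | step {w = c'} {vs = vs} a p , c∉vs ∷ uq = c' , grows , shrinks
    where
    c≢c' : c ≢ c'
    c≢c' = All.lookup c∉vs (walk-start p)

    away : ∀ v → ¬ c' ∈ₗ path c v → path c' v ≡ c' ∷ path c v
    away v c'∉ = path-unique (step (Adj-sym a) (path-walk c v) , ¬Any⇒All¬ _ c'∉ ∷ proj₂ (path-isPath c v))

    towards : ∀ v → c' ∈ₗ path c v → suc (length (path c' v)) ≤ length (path c v)
    towards v c'∈ with path c v | path-isPath c v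
    towards v (here refl) | _ | here , _ = contradiction refl c≢c'
    towards v (here refl) | _ | step _ _ , _ = contradiction refl c≢c'
    towards v (there c'∈) | _ | step _ q , _ ∷ uq' with suffix (q , uq') c'∈
    ... | ws , r , _ , ws≤ rewrite path-unique r = s≤s ws≤

    grows : ∀ v → length (path c' v) ≤ suc (length (path c v))
    grows v with c' ∈path? c , v
    ... | yes c'∈ = ≤-trans (n≤1+n _) (≤-trans (towards v c'∈) (n≤1+n _))
    ... | no  c'∉ = ≤-reflexive (cong length (away v c'∉))

    shrinks : ∀ v → ¬ c ∈ₗ path x v → suc (length (path c' v)) ≤ length (path c v)
    shrinks v c∉xv with c' ∈path? c , v
    ... | yes c'∈ = towards v c'∈
    -- Here `path c' v` passes through `c`, so `c` lies on `path c' x` or on `path x v`. The first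
    -- is the tail of the simple path from `c` to `x`; the second is excluded by assumption.
    ... | no  c'∉ with path-triangle {v = x} (subst (c ∈ₗ_) (sym (away v c'∉)) (there (start∈path c v)))
    ...   | inj₁ c∈c'x = contradiction refl (All.lookup c∉vs (subst (c ∈ₗ_) (path-unique (p , uq)) c∈c'x))
    ...   | inj₂ c∈xv  = contradiction c∈xv c∉xv

  -- Centroids

  module _ {D : Fin n → Set} (D? : Decidable D) where

    private
      beyond? : ∀ c x → Decidable (λ v → D v × ¬ c ∈ₗ path x v)
      beyond? c x v = D? v ×-dec ¬? (c ∈path? x , v)

      far : Fin n → ℕ
      far c = ∑ (λ v → χ (D? v) * length (path c v))

      nearest : Fin n → ∃[ c ] (⊤ × (∀ c' → ⊤ → far c ≤ far c'))
      nearest root = directed⇒least (λ c c' → far c ≤ far c') ≤-trans (λ _ → yes tt) nearer {root} tt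
        where
        nearer : ∀ {x y} → ⊤ → ⊤ → ∃[ z ] (⊤ × far z ≤ far x × far z ≤ far y)
        nearer {x} {y} _ _ with ≤-total (far x) (far y)
        ... | inj₁ x≤y = x , tt , ≤-refl , x≤y
        ... | inj₂ y≤x = y , tt , y≤x , ≤-refl

      -- The share of one vertex in the centroid estimate, with `l` and `l'` its path lengths before
      -- and after the step. If `B` holds, the length grows by at most one; otherwise it drops by at
      -- least one, and adding 2 still gives at most `l + 1`.
      step-cost : ∀ {l l'} (a? : Dec A) (b? : Dec B) → l' ≤ suc l → (¬ B → suc l' ≤ l) →
                  χ a? * l' + 2 * χ (a? ×-dec ¬? b?) ≤ χ a? * l + χ a?
      step-cost (no _) _ _ _ = z≤n
      step-cost {l = l} {l'} (yes _) (yes _) l'≤1+l _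
        rewrite +-identityʳ l' | +-identityʳ l' | +-identityʳ l | +-comm l 1 = l'≤1+l
      step-cost {l = l} {l'} (yes _) (no ¬b) _ l'<l
        rewrite +-identityʳ l' | +-identityʳ l | +-suc l' 1 = +-monoˡ-≤ 1 (l'<l ¬b)

    -- A vertex minimising the sum of the distances to D is a centroid: moving it one step
    -- towards x brings it closer to every v in D whose path to x avoids it.
    centroid : Fin n → ∃[ c ] (∀ x → 2 * count (beyond? c x) ≤ count D?)
    centroid root with nearest root
    ... | c , _ , c-nearest = c , half
      where
      open ≤-Reasoning
      half : ∀ x → 2 * count (beyond? c x) ≤ count D?
      half x with x ≟ c
      ... | yes refl = ≤-trans
        (≤-reflexive (cong (2 *_) (count-none (beyond? c c) λ v (_ , c∉) → c∉ (start∈path c v)))) z≤n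
      ... | no x≢c with step-towards x≢c
      -- Summing `step-cost` over all vertices and using `far c ≤ far c'` lets `far c'` cancel.
      ...   | c' , grows , shrinks = +-cancelˡ-≤ (far c') _ _ (begin
        far c' + 2 * count (beyond? c x)
          ≡⟨ cong (far c' +_) (*-distribˡ-sum 2 (λ v → χ (beyond? c x v))) ⟩
        far c' + ∑ (λ v → 2 * χ (beyond? c x v))
          ≡⟨ ∑-distrib-+ _ (λ v → 2 * χ (beyond? c x v)) ⟨
        ∑ (λ v → χ (D? v) * length (path c' v) + 2 * χ (beyond? c x v))
          ≤⟨ ∑-mono (λ v → step-cost (D? v) (c ∈path? x , v) (grows v) (shrinks v)) ⟩
        ∑ (λ v → χ (D? v) * length (path c v) + χ (D? v))
          ≡⟨ ∑-distrib-+ _ (λ v → χ (D? v)) ⟩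
        far c + count D?
          ≤⟨ +-monoˡ-≤ (count D?) (c-nearest c' tt) ⟩
        far c' + count D?  ∎)

-- Optimal hierarchical labelings

module Optimal {n} (G : Graph n) (tree : IsTree G) (H : Labeling G)
               (hier : IsHierarchical G H) (opt : IsOptimalHL₁ G H) where
  open TreePaths G tree

  _⪯_ : Fin n → Fin n → Set
  w ⪯ v = w ∈ₛ H v

  _⪯?_ : ∀ w v → Dec (w ⪯ v)
  w ⪯? v = w ∈? H v

  ⪯-refl : ∀ {w} → w ⪯ w
  ⪯-refl = proj₁ hier _

  ⪯-trans : ∀ {x y z} → x ⪯ y → y ⪯ z → x ⪯ z
  ⪯-trans = proj₂ (proj₂ hier) _ _ _

  hub : ∀ u v → ∃[ w ] (w ⪯ u × w ⪯ v × w ∈ₗ path u v)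
  hub u v = proj₁ opt u v _ (path-isPath u v)

  optimal-∑ : ∀ H' → IsHubLabeling G H' → ∑ (λ v → ∣ H v ∣) ≤ ∑ (λ v → ∣ H' v ∣)
  optimal-∑ H' hubH' = begin
    ∑ (λ v → ∣ H v ∣)    ≡⟨ sum-allFin (λ v → ∣ H v ∣) ⟨
    totalSize G H        ≤⟨ proj₂ opt H' hubH' ⟩
    totalSize G H'       ≡⟨ sum-allFin (λ v → ∣ H' v ∣) ⟩
    ∑ (λ v → ∣ H' v ∣)   ∎
    where open ≤-Reasoning

  -- Any two vertices of the path share a hub between them, which by convexity is again on the path;
  -- so the path is directed downwards.
  path-least : ∀ u v → ∃[ z ] (z ∈ₗ path u v × (∀ y → y ∈ₗ path u v → z ⪯ y))
  path-least u v = directed⇒least _⪯_ ⪯-trans (_∈path? u , v) directed (start∈path u v)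
    where
    directed : ∀ {x y} → x ∈ₗ path u v → y ∈ₗ path u v → ∃[ z ] (z ∈ₗ path u v × z ⪯ x × z ⪯ y)
    directed {x} {y} x∈ y∈ with hub x y
    ... | z , z⪯x , z⪯y , z∈ = z , path-convex x∈ y∈ z∈ , z⪯x , z⪯y

  -- The labeling `H'` keeps only the hubs with this property. It is contained in `H` and still a
  -- hub labeling, so optimality of `H` forces equality at every vertex.
  hub-least-on-path : ∀ {w u} → w ⪯ u → ∀ {x} → x ∈ₗ path w u → w ⪯ x
  hub-least-on-path {w} {u} w⪯u {x} x∈ = ∈-subset⁻ (least? u) (H⊆H' w⪯u) x x∈
    where
    least? : ∀ u → Decidable (λ w → ∀ x → x ∈ₗ path w u → w ⪯ x)
    least? u w = all? (λ x → (x ∈path? w , u) →-dec (w ⪯? x))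

    H' : Labeling G
    H' u = subset (least? u)

    H'⊆H : ∀ {u w} → w ∈ₛ H' u → w ⪯ u
    H'⊆H {u} {w} w∈ = ∈-subset⁻ (least? u) w∈ u (end∈path w u)

    H'-hub : IsHubLabeling G H'
    H'-hub u v vs p with path-least u v | path-unique p
    -- The least vertex of the whole path precedes both of its subpaths to `u` and to `v`, so it
    -- survives in both labels.
    ... | z , z∈ , z⪯ | refl = z
      , ∈-subset⁺ (least? u) (λ x x∈ → z⪯ x (path-convex z∈ (start∈path u v) x∈))
      , ∈-subset⁺ (least? v) (λ x x∈ → z⪯ x (path-convex z∈ (end∈path u v) x∈))
      , z∈

    H⊆H' : w ⪯ u → w ∈ₛ H' u
    H⊆H' w⪯u with w ∈? H' u
    ... | yes w∈ = w∈
    ... | no  w∉ = contradiction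
      (∑-tight (λ v → p⊆q⇒∣p∣≤∣q∣ H'⊆H) (optimal-∑ H' H'-hub) u)
      (<⇒≱ (p⊂q⇒∣p∣<∣q∣ (H'⊆H , w , w⪯u , w∉)))

  -- The least vertex `z` of `path w w'` lies on the path from `u` to `w` or to `w'`. That hub
  -- precedes `z`, and `z` precedes the other hub.
  hubs-chain : ∀ {w w' u} → w ⪯ u → w' ⪯ u → w ⪯ w' ⊎ w' ⪯ w
  hubs-chain {w} {w'} {u} w⪯u w'⪯u with path-least w w'
  ... | z , z∈ , z⪯ with path-triangle {v = u} z∈
  ...   | inj₁ z∈wu  = inj₁ (⪯-trans (hub-least-on-path w⪯u z∈wu) (z⪯ w' (end∈path w w')))
  ...   | inj₂ z∈uw' = inj₂ (⪯-trans (hub-least-on-path w'⪯u (path-sym z∈uw')) (z⪯ w (start∈path w w')))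

  -- Weights of hubs

  d : Fin n → ℕ
  d w = count (w ⪯?_)

  Heavy : Fin n → Fin n → Set
  Heavy w x = w ⪯ x × 3 * d w < 4 * d x

  heavy? : ∀ w → Decidable (Heavy w)
  heavy? w x = (w ⪯? x) ×-dec (3 * d w <? 4 * d x)

  -- Rerouting through one vertex

  module Reroute (w c : Fin n) where

    Redundant : Fin n → Fin n → Set
    Redundant v x = w ⪯ x × x ⪯ v × c ∈ₗ path x v

    redundant? : ∀ v → Decidable (Redundant v)
    redundant? v x = (w ⪯? x) ×-dec (x ⪯? v) ×-dec (c ∈path? x , v)

    -- Equality with `c` is phrased as membership in `⁅ c ⁆` so that it is counted by the size of a
    -- singleton.
    added? : ∀ v → Decidable (λ x → x ∈ₛ ⁅ c ⁆ × w ⪯ v)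
    added? v x = (x ∈? ⁅ c ⁆) ×-dec (w ⪯? v)

    rerouted? : ∀ v → Decidable (λ x → (x ⪯ v × ¬ Redundant v x) ⊎ (x ∈ₛ ⁅ c ⁆ × w ⪯ v))
    rerouted? v x = ((x ⪯? v) ×-dec ¬? (redundant? v x)) ⊎-dec added? v x

    H' : Labeling G
    H' v = subset (rerouted? v)

    -- If `w` precedes both ends and `c` lies between them, `c` serves the pair. Otherwise the old
    -- hub `z` was discarded at neither end: a discard would give `w ⪯ z`, hence `w ⪯ u` and
    -- `w ⪯ v`, and put `c` on a subpath of `path u v`.
    H'-hub : IsHubLabeling G H'
    H'-hub u v vs p with path-unique p
    ... | refl with (w ⪯? u) ×-dec (w ⪯? v) ×-dec (c ∈path? u , v)
    ...   | yes (w⪯u , w⪯v , c∈) = c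
      , ∈-subset⁺ (rerouted? u) (inj₂ (x∈⁅x⁆ c , w⪯u))
      , ∈-subset⁺ (rerouted? v) (inj₂ (x∈⁅x⁆ c , w⪯v))
      , c∈
    ...   | no ¬both with hub u v
    ...     | z , z⪯u , z⪯v , z∈ = z
      , ∈-subset⁺ (rerouted? u) (inj₁ (z⪯u , λ (w⪯z , _ , c∈) →
          ¬both (⪯-trans w⪯z z⪯u , ⪯-trans w⪯z z⪯v , path-convex z∈ (start∈path u v) c∈)))
      , ∈-subset⁺ (rerouted? v) (inj₁ (z⪯v , λ (w⪯z , _ , c∈) →
          ¬both (⪯-trans w⪯z z⪯u , ⪯-trans w⪯z z⪯v , path-convex z∈ (end∈path u v) c∈)))
      , z∈

    count-added : ∀ v → count (added? v) ≤ χ (w ⪯? v)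
    count-added v with w ⪯? v
    ... | no w⋠v = ≤-reflexive (count-none (λ x → (x ∈? ⁅ c ⁆) ×-dec no w⋠v) (λ _ → w⋠v ∘ proj₂))
    ... | yes w⪯v = begin
      count (λ x → (x ∈? ⁅ c ⁆) ×-dec yes w⪯v)   ≤⟨ count-mono (λ x → (x ∈? ⁅ c ⁆) ×-dec yes w⪯v) (_∈? ⁅ c ⁆) (λ _ → proj₁) ⟩
      count (_∈? ⁅ c ⁆)                          ≡⟨ ∣p∣≡count ⁅ c ⁆ ⟨
      ∣ ⁅ c ⁆ ∣                                  ≡⟨ ∣⁅x⁆∣≡1 c ⟩
      1                                          ∎
      where open ≤-Reasoning

    -- Only an inequality, since `c` may already belong to `H v`.
    exchange : ∀ v → ∣ H' v ∣ + count (redundant? v) ≤ ∣ H v ∣ + χ (w ⪯? v)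
    exchange v = begin
      ∣ H' v ∣ + count (redundant? v)          ≡⟨ cong (_+ count (redundant? v)) (∣p∣≡count (H' v)) ⟩
      count (_∈? H' v) + count (redundant? v)
        ≤⟨ count-exchange (_∈? H' v) (redundant? v) (_⪯? v) (added? v) (λ x → ∈-subset⁻ (rerouted? v)) (λ x → proj₁ ∘ proj₂) ⟩
      count (_⪯? v) + count (added? v)         ≤⟨ +-monoʳ-≤ (count (_⪯? v)) (count-added v) ⟩
      count (_⪯? v) + χ (w ⪯? v)               ≡⟨ cong (_+ χ (w ⪯? v)) (∣p∣≡count (H v)) ⟨
      ∣ H v ∣ + χ (w ⪯? v)                     ∎
      where open ≤-Reasoning

    savings : Fin n → ℕ
    savings x = count (λ v → redundant? v x)

    -- Optimality bounds the total number of discarded hubs by the total number of additions; double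
    -- counting regroups the discards by hub `x` instead of by vertex `v`.
    ∑-savings : ∑ savings ≤ d w
    ∑-savings = +-cancelˡ-≤ (∑ (λ v → ∣ H v ∣)) _ _ (begin
      ∑ (λ v → ∣ H v ∣) + ∑ savings                          ≤⟨ +-monoˡ-≤ (∑ savings) (optimal-∑ H' H'-hub) ⟩
      ∑ (λ v → ∣ H' v ∣) + ∑ savings                         ≡⟨ cong (∑ (λ v → ∣ H' v ∣) +_) (∑-comm (λ v x → χ (redundant? v x))) ⟨
      ∑ (λ v → ∣ H' v ∣) + ∑ (λ v → count (redundant? v))    ≡⟨ ∑-distrib-+ _ (λ v → count (redundant? v)) ⟨
      ∑ (λ v → ∣ H' v ∣ + count (redundant? v))              ≤⟨ ∑-mono exchange ⟩
      ∑ (λ v → ∣ H v ∣ + χ (w ⪯? v))                         ≡⟨ ∑-distrib-+ _ (λ v → χ (w ⪯? v)) ⟩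
      ∑ (λ v → ∣ H v ∣) + d w                                ∎)
      where open ≤-Reasoning

  -- With `c` a centroid, each heavy `x` saves more than a quarter of `d w`, while all savings
  -- together are at most `d w`. Using `suc (d w)` as the Markov threshold makes the final
  -- comparison strict, so fewer than four are heavy.
  count-heavy : ∀ w → count (heavy? w) ≤ 3
  count-heavy w with centroid (w ⪯?_) w
  ... | c , half = ≤-pred (*-cancelʳ-< (suc (d w)) (count (heavy? w)) 4 (begin-strict
      count (heavy? w) * suc (d w)     ≤⟨ count-markov (heavy? w) (λ x → 4 * savings x) (suc (d w)) heavy-savings ⟩
      ∑ (λ x → 4 * savings x)          ≡⟨ *-distribˡ-sum 4 savings ⟨
      4 * ∑ savings                    ≤⟨ *-monoʳ-≤ 4 ∑-savings ⟩
      4 * d w                          <⟨ *-monoʳ-< 4 (n<1+n (d w)) ⟩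
      4 * suc (d w)                    ∎))
    where
    open ≤-Reasoning
    open Reroute w c
    heavy-savings : ∀ x → Heavy w x → d w < 4 * savings x
    -- The vertices counted by `d x` either have `c` on their path to `x` and are saved, or lie
    -- beyond the centroid, where there are at most half of `d w`.
    heavy-savings x (w⪯x , 3dw<4dx) = +-cancelʳ-< (2 * d w) (d w) (4 * savings x) (begin-strict
      3 * d w                                    <⟨ 3dw<4dx ⟩
      4 * d x                                    ≤⟨ *-monoʳ-≤ 4 (count-cover (x ⪯?_) (λ v → redundant? v x) beyond? split) ⟩
      4 * (savings x + count beyond?)            ≡⟨ *-distribˡ-+ 4 (savings x) _ ⟩
      4 * savings x + 4 * count beyond?          ≡⟨ cong (4 * savings x +_) (*-assoc 2 2 (count beyond?)) ⟩
      4 * savings x + 2 * (2 * count beyond?)    ≤⟨ +-monoʳ-≤ (4 * savings x) (*-monoʳ-≤ 2 (half x)) ⟩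
      4 * savings x + 2 * d w                    ∎)
      where
      beyond? : Decidable (λ v → w ⪯ v × ¬ c ∈ₗ path x v)
      beyond? v = (w ⪯? v) ×-dec ¬? (c ∈path? x , v)
      split : ∀ v → x ⪯ v → Redundant v x ⊎ (w ⪯ v × ¬ c ∈ₗ path x v)
      split v x⪯v with c ∈path? x , v
      ... | yes c∈ = inj₁ (w⪯x , x⪯v , c∈)
      ... | no  c∉ = inj₂ (⪯-trans w⪯x x⪯v , c∉)

  -- light? k u tests d x < (4/3)^k.
  light? : ∀ k u → Decidable (λ x → x ⪯ u × 3 ^ k * d x < 4 ^ k)
  light? k u x = (x ⪯? u) ×-dec (3 ^ k * d x <? 4 ^ k)

  -- Induction on `k`. The light hubs form a chain with least element `w`; each is heavy for `w`,
  -- which happens at most three times, or its weight is at most 3/4 of `d w`, which makes it light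
  -- one level lower.
  count-light : ∀ k u → count (light? k u) ≤ 3 * k
  -- No hub is light at level 0, because `x ⪯ x` makes `d x` positive.
  count-light zero u = ≤-reflexive (count-none (light? 0 u) λ x (_ , dx<1) →
    <⇒≱ (subst (_< 1) (+-identityʳ (d x)) dx<1) (count-positive (x ⪯?_) x ⪯-refl))
  count-light (suc k) u with any? (light? (suc k) u)
  ... | no none = ≤-trans (≤-reflexive (count-none (light? (suc k) u) (λ x l → none (x , l)))) z≤n
  ... | yes (_ , light) with directed⇒least _⪯_ ⪯-trans (light? (suc k) u) directed light
    where
    directed : ∀ {x y} → x ⪯ u × 3 ^ suc k * d x < 4 ^ suc k → y ⪯ u × 3 ^ suc k * d y < 4 ^ suc k →
               ∃[ z ] ((z ⪯ u × 3 ^ suc k * d z < 4 ^ suc k) × z ⪯ x × z ⪯ y)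
    directed {x} {y} lx ly with hubs-chain (proj₁ lx) (proj₁ ly)
    ... | inj₁ x⪯y = x , lx , ⪯-refl , x⪯y
    ... | inj₂ y⪯x = y , ly , y⪯x , ⪯-refl
  ...   | w , (_ , w-light) , w-least = begin
    count (light? (suc k) u)                ≤⟨ count-cover (light? (suc k) u) (heavy? w) (light? k u) heavy-or-light ⟩
    count (heavy? w) + count (light? k u)   ≤⟨ +-mono-≤ (count-heavy w) (count-light k u) ⟩
    3 + 3 * k                               ≡⟨ *-suc 3 k ⟨
    3 * suc k                               ∎
    where
    open ≤-Reasoning
    heavy-or-light : ∀ x → x ⪯ u × 3 ^ suc k * d x < 4 ^ suc k → Heavy w x ⊎ (x ⪯ u × 3 ^ k * d x < 4 ^ k)
    heavy-or-light x l@(x⪯u , _) with 3 * d w <? 4 * d x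
    ... | yes 3dw<4dx = inj₁ (w-least x l , 3dw<4dx)
    ... | no  3dw≮4dx = inj₂ (x⪯u , *-cancelˡ-< 4 (3 ^ k * d x) (4 ^ k) (begin-strict
      4 * (3 ^ k * d x)    ≡⟨ move 4 (3 ^ k) (d x) ⟩
      3 ^ k * (4 * d x)    ≤⟨ *-monoʳ-≤ (3 ^ k) (≮⇒≥ 3dw≮4dx) ⟩
      3 ^ k * (3 * d w)    ≡⟨ move 3 (3 ^ k) (d w) ⟨
      3 * (3 ^ k * d w)    ≡⟨ *-assoc 3 (3 ^ k) (d w) ⟨
      3 ^ suc k * d w      <⟨ w-light ⟩
      4 ^ suc k            ∎))
      where
      move : ∀ a b c → a * (b * c) ≡ b * (a * c)
      move = solve-∀

  -- Three factors 4/3 make up for one factor 2, since 27 · 2 ≤ 64.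
  ∣H∣-bound : ∀ L → n < 2 ^ L → ∀ u → ∣ H u ∣ ≤ 9 * L
  ∣H∣-bound L n<2^L u = begin
    ∣ H u ∣                    ≡⟨ ∣p∣≡count (H u) ⟩
    -- At level `3 * L` every hub is light, since `d x ≤ n < 2 ^ L`.
    count (_⪯? u)              ≤⟨ count-mono (_⪯? u) (light? (3 * L) u) (λ x x⪯u → x⪯u , all-light x) ⟩
    count (light? (3 * L) u)   ≤⟨ count-light (3 * L) u ⟩
    3 * (3 * L)                ≡⟨ *-assoc 3 3 L ⟨
    9 * L                      ∎
    where
    open ≤-Reasoning
    all-light : ∀ x → 3 ^ (3 * L) * d x < 4 ^ (3 * L)
    all-light x = begin-strict
      3 ^ (3 * L) * d x    ≡⟨ cong (_* d x) (^-*-assoc 3 3 L) ⟨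
      27 ^ L * d x         ≤⟨ *-monoʳ-≤ (27 ^ L) (count≤n (x ⪯?_)) ⟩
      27 ^ L * n           <⟨ *-monoʳ-< (27 ^ L) {{m^n≢0 27 L}} n<2^L ⟩
      27 ^ L * 2 ^ L       ≡⟨ ^-distribˡ-* 27 2 L ⟨
      54 ^ L               ≤⟨ ^-monoˡ-≤ L (m≤m+n 54 10) ⟩
      64 ^ L               ≡⟨ ^-*-assoc 4 3 L ⟩
      4 ^ (3 * L)          ∎

-- The logarithmic bound

n<2^[1+⌊log₂n⌋] : ∀ n → n < 2 ^ suc ⌊log₂ n ⌋
-- Otherwise monotonicity of the rounded logarithm would make it at least one larger than itself.
n<2^[1+⌊log₂n⌋] n = ≰⇒> λ 2^≤n → 1+n≰n
  (subst (_≤ ⌊log₂ n ⌋) (⌊log₂[2^n]⌋≡n (suc ⌊log₂ n ⌋)) (⌊log₂⌋-mono-≤ 2^≤n))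

mainTheorem8 : ∃[ C ] ∃[ N ] (∀ (n : ℕ) → N ≤ n → (G : Graph n) → IsTree G →
    (H : Labeling G) → IsHierarchical G H → IsOptimalHL₁ G H →
    ∀ (u : Fin n) → ∣ H u ∣ ≤ C * ⌊log₂ n ⌋)
mainTheorem8 = 18 , 2 , λ n 2≤n G tree H hier opt u → begin
  ∣ H u ∣                          ≤⟨ Optimal.∣H∣-bound G tree H hier opt (suc ⌊log₂ n ⌋) (n<2^[1+⌊log₂n⌋] n) u ⟩
  -- From `2 ≤ n` the logarithm is at least 1 and absorbs the successor, which doubles 9 to 18.
  9 * suc ⌊log₂ n ⌋                ≤⟨ *-monoʳ-≤ 9 (+-monoˡ-≤ ⌊log₂ n ⌋ (⌊log₂⌋-mono-≤ 2≤n)) ⟩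
  9 * (⌊log₂ n ⌋ + ⌊log₂ n ⌋)      ≡⟨ double ⌊log₂ n ⌋ ⟩
  18 * ⌊log₂ n ⌋                   ∎
  where
  open ≤-Reasoning
  double : ∀ l → 9 * (l + l) ≡ 18 * l
  double = solve-∀
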